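{- Let $n \ge 1$ and let $T_n$ be the $n\times n$ matrix with entries $t_{ij} = |i-j|$ for $i,j = 1,\ldots,n$. Then $T_n$ is solvable if and only if $n \equiv 0$ or $1 \pmod 4$. Equivalently: there exists a permutation $f:\{1,\ldots,n\}\to\{1,\ldots,n\}$ such that $|f(i)-i|$ takes each of the values $0,1,\ldots,n-1$ exactly once (as $i$ ranges over $\{1,\ldots,n\}$) if and only if $n \equiv 0$ or $1 \pmod 4$.
   Context: $T_n$ is called solvable if one can select $n$ entries of $T_n$, no two in the same row or the same column, whose values are exactly $0,1,\ldots,n-1$ (each value once). -}

module Defs where

open import Data.Fin using (Fin; toℕ)
open import Data.Nat using (ℕ; suc; _<_; _%_; ∣_-_∣)
open import Data.Product using (Σ-syntax; _×_; ∃!; proj₁; proj₂)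
open import Data.Fin.Permutation using (Permutation′; _⟨$⟩ʳ_)
open import Data.Sum using (_⊎_)
open import Function using (_∘_)
open import Function.Definitions using (Injective)
open import Relation.Binary.PropositionalEquality using (_≡_)

Matrix : ℕ → Set
Matrix n = Fin n → Fin n → ℕ

-- `Fin n` counts from 0; ⟦ i ⟧ is the corresponding index in {1,…,n}.
⟦_⟧ : ∀ {n} → Fin n → ℕ
⟦ i ⟧ = suc (toℕ i)

T : ∀ n → Matrix n
T n i j = ∣ ⟦ i ⟧ - ⟦ j ⟧ ∣

TakesEachOnce : ∀ {n} → (Fin n → ℕ) → Set
TakesEachOnce {n} g = ∀ v → v < n → ∃! _≡_ λ (k : Fin n) → g k ≡ v

-- A selection of n entries is given by listing their positions (row , column);
-- the two injectivity conditions say that no two share a row or a column.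
Solvable : ∀ {n} → Matrix n → Set
Solvable {n} M =
  Σ[ pos ∈ (Fin n → Fin n × Fin n) ]
    Injective _≡_ _≡_ (proj₁ ∘ pos) ×
    Injective _≡_ _≡_ (proj₂ ∘ pos) ×
    (let value = λ k → M (proj₁ (pos k)) (proj₂ (pos k)) in
     (∀ k → value k < n) × TakesEachOnce value)

HasDifferencePermutation : ℕ → Set
HasDifferencePermutation n =
  Σ[ f ∈ Permutation′ n ] TakesEachOnce (λ i → ∣ ⟦ f ⟨$⟩ʳ i ⟧ - ⟦ i ⟧ ∣)

ZeroOrOneMod4 : ℕ → Set
ZeroOrOneMod4 n = n % 4 ≡ 0 ⊎ n % 4 ≡ 1

{-# OPTIONS --safe #-}
module Submission where

-- Modulo 2 the selected values add up to the sum of all row indices plus the sum of all column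
-- indices, hence to 0; so 0 + 1 + ... + (n-1) is even and n is 0 or 1 mod 4.  Conversely, a
-- graceful labelling of the cycle with n - 1 edges uses all but one of n labels and its edges
-- have the differences 1, ..., n-1; walking around the cycle and fixing the unused label gives
-- the permutation.  Rosa's labellings are cut into blocks of nested arcs x ↦ c - x.

open import Defs
open import Data.Nat using (ℕ; _≥_)
open import Data.Product using (_×_)
open import Function.Bundles using (_⇔_)

open import Data.Fin using (Fin; zero; toℕ; fromℕ<; punchOut)
open import Data.Fin.Permutation
  using (Permutation′; _⟨$⟩ʳ_; _⟨$⟩ˡ_; permutation; inverseˡ; inverseʳ; flip; _∘ₚ_)
  renaming (id to idₚ)
open import Data.Fin.Properties
  using (_≟_; any?; toℕ<n; toℕ-fromℕ<; toℕ-injective; punchOut-injective; injective⇒≤)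
open import Data.List using (List; []; _∷_; applyUpTo; length; lookup; concatMap; foldr)
open import Data.List.Membership.Propositional using (_∈_; lose)
open import Data.List.Properties using (length-++; length-applyUpTo)
open import Data.List.Relation.Unary.Any using (Any; here; there; index)
open import Data.List.Relation.Unary.Any.Properties using (applyUpTo⁺; concatMap⁺; lookup-index)
open import Data.Nat
  using (zero; suc; s≤s; s<s⁻¹; _+_; _*_; _∸_; _≤_; _<_; _/_; _%_; _≤?_; ∣_-_∣; parity)
open import Data.Nat.DivMod using (m≡m%n+[m/n]*n; m%n<n; %-remove-+ˡ)
open import Data.Nat.Divisibility using (∣-refl)
open import Data.Nat.Properties hiding (_≟_)
open import Data.Nat.Tactic.RingSolver using (solve-∀)
open import Data.Parity using (Parity; 0ℙ; 1ℙ) renaming (_+_ to _+ᴾ_; _⁻¹ to _⁻¹ᴾ)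
open import Data.Parity.Properties using (p+p≡0ℙ; suc-homo-⁻¹; ⁻¹-involutive)
  renaming (+-identityʳ to +ᴾ-identityʳ; +-0-commutativeMonoid to ℙ-commutativeMonoid)
open import Data.Product using (Σ-syntax; ∃; _,_; proj₁; proj₂; swap)
open import Data.Sum using (_⊎_; inj₁; inj₂)
open import Function using (id; _∘_; mk⇔)
open import Function.Definitions using (Injective)
open import Relation.Binary.PropositionalEquality
open import Relation.Nullary using (yes; no; contradiction)
import Algebra.Properties.CommutativeMonoid.Sum ℙ-commutativeMonoid as ΣP

-- Permutations of `Fin n` from injections and from coverings.

-- Pigeonhole: if `f` missed `y`, punching `y` out would inject `Fin (suc n)` into `Fin n`.
injective⇒hits : ∀ {n} {f : Fin n → Fin n} → Injective _≡_ _≡_ f → ∀ y → ∃ λ x → f x ≡ y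
injective⇒hits {suc n} {f} inj y with any? (λ x → f x ≟ y)
... | yes hit  = hit
... | no  miss = contradiction (injective⇒≤ squeeze-injective) 1+n≰n
  where
  avoids : ∀ x → y ≢ f x
  avoids x y≡fx = miss (x , sym y≡fx)
  squeeze-injective : Injective _≡_ _≡_ (λ x → punchOut (avoids x))
  squeeze-injective = inj ∘ punchOut-injective (avoids _) (avoids _)

injective⇒permutation : ∀ {n} (f : Fin n → Fin n) → Injective _≡_ _≡_ f → Permutation′ n
injective⇒permutation f inj =
  permutation f (proj₁ ∘ injective⇒hits inj) (proj₂ ∘ injective⇒hits inj)
    (λ x → inj (proj₂ (injective⇒hits inj (f x))))

-- A choice of preimages is injective because `g` undoes it, so it is a permutation `σ`, and `g` is
-- the inverse of `σ`.
covering⇒permutation : ∀ {n} (g : Fin n → ℕ) → (∀ v → ∃ λ k → g k ≡ toℕ v) →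
                       Σ[ π ∈ Permutation′ n ] ∀ k → g k ≡ toℕ (π ⟨$⟩ʳ k)
covering⇒permutation g cover = flip σ , λ k →
  trans (cong g (sym (inverseʳ σ))) (proj₂ (cover (σ ⟨$⟩ˡ k)))
  where
  section-injective : Injective _≡_ _≡_ (proj₁ ∘ cover)
  section-injective {u} {v} eq = toℕ-injective
    (trans (sym (proj₂ (cover u))) (trans (cong g eq) (proj₂ (cover v))))
  σ = injective⇒permutation (proj₁ ∘ cover) section-injective

-- Necessity: the parity of the sum of the values.

parity-∣-∣ : ∀ a b → parity ∣ a - b ∣ ≡ parity a +ᴾ parity b
parity-∣-∣ zero    b       = refl
parity-∣-∣ (suc a) zero    = sym (+ᴾ-identityʳ _)
parity-∣-∣ (suc a) (suc b) = begin
  parity ∣ a - b ∣                          ≡⟨ parity-∣-∣ a b ⟩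
  parity a +ᴾ parity b                      ≡⟨ cong₂ _+ᴾ_ (suc-homo-⁻¹ a) (suc-homo-⁻¹ b) ⟨
  (parity (suc a) ⁻¹ᴾ) +ᴾ (parity (suc b) ⁻¹ᴾ) ≡⟨ ⁻¹-cancel (parity (suc a)) (parity (suc b)) ⟩
  parity (suc a) +ᴾ parity (suc b)          ∎
  where
  open ≡-Reasoning
  ⁻¹-cancel : ∀ p q → (p ⁻¹ᴾ) +ᴾ (q ⁻¹ᴾ) ≡ p +ᴾ q
  ⁻¹-cancel 0ℙ q = ⁻¹-involutive q
  ⁻¹-cancel 1ℙ q = refl

Σparity : ℕ → Parity
Σparity n = ΣP.sum {n} (parity ∘ toℕ)

-- Induction in steps of 4: the parities 0, 1, 0, 1 of the first four terms compute to two flips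
-- `⁻¹ᴾ`, which cancel.
Σparity≡0⇒mod4 : ∀ n → Σparity n ≡ 0ℙ → ZeroOrOneMod4 n
Σparity≡0⇒mod4 0 _ = inj₁ refl
Σparity≡0⇒mod4 1 _ = inj₂ refl
Σparity≡0⇒mod4 2 ()
Σparity≡0⇒mod4 3 ()
Σparity≡0⇒mod4 (suc (suc (suc (suc n)))) eq =
  subst (λ r → r ≡ 0 ⊎ r ≡ 1) (sym (%-remove-+ˡ n ∣-refl))
    (Σparity≡0⇒mod4 n (trans (sym (⁻¹-involutive (Σparity n))) eq))

-- Two permutations serve both formulations at once: a selection lists its rows and columns by `ρ`
-- and `κ`, and a difference permutation is the case `κ = idₚ`.
transversal⇒mod4 : ∀ {n} (ρ κ : Permutation′ n) →
  TakesEachOnce (λ k → T n (ρ ⟨$⟩ʳ k) (κ ⟨$⟩ʳ k)) → ZeroOrOneMod4 n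
transversal⇒mod4 {n} ρ κ once = Σparity≡0⇒mod4 n (begin
  Σparity n                                        ≡⟨ ΣP.sum-permute (parity ∘ toℕ) π ⟩
  ΣP.sum (λ k → parity (toℕ (π ⟨$⟩ʳ k)))           ≡⟨ ΣP.sum-cong-≗ (λ k → cong parity (value≡π k)) ⟨
  ΣP.sum (λ k → parity (value k))                  ≡⟨ ΣP.sum-cong-≗ (λ k → parity-∣-∣ (row k) (col k)) ⟩
  ΣP.sum (λ k → parity (row k) +ᴾ parity (col k))  ≡⟨ ΣP.∑-distrib-+ (parity ∘ row) (parity ∘ col) ⟩
  ΣP.sum (parity ∘ row) +ᴾ ΣP.sum (parity ∘ col)   ≡⟨ cong₂ _+ᴾ_ (ΣP.sum-permute (parity ∘ toℕ) ρ)
                                                                 (ΣP.sum-permute (parity ∘ toℕ) κ) ⟨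
  Σparity n +ᴾ Σparity n                           ≡⟨ p+p≡0ℙ (Σparity n) ⟩
  0ℙ                                               ∎)
  where
  open ≡-Reasoning
  row col value : Fin n → ℕ
  -- Counting from 0 suffices, since the two `suc` of `⟦_⟧` cancel by computation inside `T`.
  row k = toℕ (ρ ⟨$⟩ʳ k)
  col k = toℕ (κ ⟨$⟩ʳ k)
  value k = T n (ρ ⟨$⟩ʳ k) (κ ⟨$⟩ʳ k)
  values = covering⇒permutation value λ v →
    let k , gk≡v , _ = once (toℕ v) (toℕ<n v) in k , gk≡v
  π = proj₁ values
  value≡π = proj₂ values

solvable⇒mod4 : ∀ {n} → Solvable (T n) → ZeroOrOneMod4 n
solvable⇒mod4 (pos , rows-inj , cols-inj , _ , once) = transversal⇒mod4
  (injective⇒permutation (proj₁ ∘ pos) rows-inj) (injective⇒permutation (proj₂ ∘ pos) cols-inj) once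

differencePermutation⇒mod4 : ∀ {n} → HasDifferencePermutation n → ZeroOrOneMod4 n
differencePermutation⇒mod4 (f , once) = transversal⇒mod4 f idₚ once

differencePermutation⇒solvable : ∀ {n} → HasDifferencePermutation n → Solvable (T n)
differencePermutation⇒solvable {n} (f , once) =
  (λ i → f ⟨$⟩ʳ i , i) , f-injective , id , bounded , once
  where
  f-injective : Injective _≡_ _≡_ (f ⟨$⟩ʳ_)
  f-injective eq = trans (sym (inverseˡ f)) (trans (cong (f ⟨$⟩ˡ_) eq) (inverseˡ f))
  bounded : ∀ k → T n (f ⟨$⟩ʳ k) k < n
  bounded k = ≤-<-trans (∣m-n∣≤m⊔n (toℕ (f ⟨$⟩ʳ k)) (toℕ k)) (⊔-lub (toℕ<n (f ⟨$⟩ʳ k)) (toℕ<n k))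

-- Sufficiency: from a list of pairs to a difference permutation.

gap : ℕ × ℕ → ℕ
gap (x , y) = ∣ x - y ∣

Hits : (ℕ × ℕ → ℕ) → List (ℕ × ℕ) → ℕ → Set
Hits g L x = Any (λ e → g e ≡ x) L

-- `L` is the graph of the map sought, in any order. As there are only `n` pairs, rows, columns and
-- gaps are permutations `ρ`, `κ`, `δ` of the positions in `L`; the map is `κ` after the inverse of
-- `ρ`, and its differences are `δ` after the inverse of `ρ`.
graph⇒differencePermutation : ∀ {n} (L : List (ℕ × ℕ)) → length L ≡ n →
  (∀ v → v < n → Hits proj₁ L v) → (∀ v → v < n → Hits proj₂ L v) → (∀ v → v < n → Hits gap L v) →
  HasDifferencePermutation n
graph⇒differencePermutation L refl rows cols gaps = flip ρ ∘ₚ κ , once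
  where
  place : (g : ℕ × ℕ → ℕ) → (∀ v → v < length L → Hits g L v) →
          Σ[ π ∈ Permutation′ (length L) ] ∀ k → g (lookup L k) ≡ toℕ (π ⟨$⟩ʳ k)
  place g cover = covering⇒permutation (g ∘ lookup L) λ v →
    let hit = cover (toℕ v) (toℕ<n v) in index hit , lookup-index hit
  ρ = proj₁ (place proj₁ rows)
  κ = proj₁ (place proj₂ cols)
  δ = proj₁ (place gap gaps)
  difference : Fin (length L) → ℕ
  difference i = T _ (κ ⟨$⟩ʳ (ρ ⟨$⟩ˡ i)) i
  difference≡δ : ∀ i → difference i ≡ toℕ (δ ⟨$⟩ʳ (ρ ⟨$⟩ˡ i))
  difference≡δ i = begin
    ∣ toℕ (κ ⟨$⟩ʳ k) - toℕ i ∣                  ≡⟨ ∣-∣-comm (toℕ (κ ⟨$⟩ʳ k)) (toℕ i) ⟩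
    ∣ toℕ i - toℕ (κ ⟨$⟩ʳ k) ∣                  ≡⟨ cong₂ ∣_-_∣
                                                    (trans (proj₂ (place proj₁ rows) k) (cong toℕ (inverseʳ ρ)))
                                                    (proj₂ (place proj₂ cols) k) ⟨
    gap (lookup L k)                            ≡⟨ proj₂ (place gap gaps) k ⟩
    toℕ (δ ⟨$⟩ʳ k)                              ∎
    where
    open ≡-Reasoning
    k = ρ ⟨$⟩ˡ i
  once : TakesEachOnce difference
  once v v<n = ρ ⟨$⟩ʳ (δ ⟨$⟩ˡ w) , hit , unique
    where
    w = fromℕ< v<n
    hit : difference (ρ ⟨$⟩ʳ (δ ⟨$⟩ˡ w)) ≡ v
    hit = begin
      difference (ρ ⟨$⟩ʳ (δ ⟨$⟩ˡ w))                  ≡⟨ difference≡δ _ ⟩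
      toℕ (δ ⟨$⟩ʳ (ρ ⟨$⟩ˡ (ρ ⟨$⟩ʳ (δ ⟨$⟩ˡ w))))       ≡⟨ cong (toℕ ∘ (δ ⟨$⟩ʳ_)) (inverseˡ ρ) ⟩
      toℕ (δ ⟨$⟩ʳ (δ ⟨$⟩ˡ w))                         ≡⟨ cong toℕ (inverseʳ δ) ⟩
      toℕ w                                           ≡⟨ toℕ-fromℕ< v<n ⟩
      v                                               ∎
      where open ≡-Reasoning
    unique : ∀ {i} → difference i ≡ v → ρ ⟨$⟩ʳ (δ ⟨$⟩ˡ w) ≡ i
    unique {i} eq = begin
      ρ ⟨$⟩ʳ (δ ⟨$⟩ˡ w)                              ≡⟨ cong (λ u → ρ ⟨$⟩ʳ (δ ⟨$⟩ˡ u)) (toℕ-injective w≡δ) ⟩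
      ρ ⟨$⟩ʳ (δ ⟨$⟩ˡ (δ ⟨$⟩ʳ (ρ ⟨$⟩ˡ i)))            ≡⟨ cong (ρ ⟨$⟩ʳ_) (inverseˡ δ) ⟩
      ρ ⟨$⟩ʳ (ρ ⟨$⟩ˡ i)                              ≡⟨ inverseʳ ρ ⟩
      i                                              ∎
      where
      open ≡-Reasoning
      w≡δ : toℕ w ≡ toℕ (δ ⟨$⟩ʳ (ρ ⟨$⟩ˡ i))
      w≡δ = trans (toℕ-fromℕ< v<n) (trans (sym eq) (difference≡δ i))

-- Intervals with affine bounds.

-- The construction below depends on a parameter p, and all its positions, sizes and gaps are
-- affine in p.  Keeping the coefficients as numerals makes every side condition hold by refl.
infix 6 _∔_·p
record Affine : Set where
  constructor _∔_·p
  field constant slope : ℕ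

infixl 5 _⊕_
_⊕_ : Affine → Affine → Affine
(a ∔ b ·p) ⊕ (c ∔ d ·p) = a + c ∔ b + d ·p

num : ℕ → Affine
num c = c ∔ 0 ·p

data Direction : Set where
  up down : Direction

orient : Direction → ℕ × ℕ → ℕ × ℕ
orient up   = id
orient down = swap

-- `low` and `high` are the first points of the two intervals that the arcs join; `up` maps low ends
-- to high ends, `down` the reverse.
record Block : Set where
  constructor block
  field
    direction     : Direction
    low high size : Affine

  rowStart colStart : Affine
  rowStart with direction
  ... | up   = low
  ... | down = high
  colStart with direction
  ... | up   = high
  ... | down = low

open Block

pattern #0 = here refl
pattern #1 = there #0
pattern #2 = there #1
pattern #3 = there #2
pattern #4 = there #3
pattern #5 = there #4

module _ (p : ℕ) where

  eval : Affine → ℕ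
  eval (c ∔ d ·p) = c + d * p

  eval-⊕ : ∀ a b → eval (a ⊕ b) ≡ eval a + eval b
  eval-⊕ (a ∔ b ·p) (c ∔ d ·p) = regroup a b c d p
    where
    regroup : ∀ a b c d p → a + c + (b + d) * p ≡ a + b * p + (c + d * p)
    regroup = solve-∀

  -- A record and not a function type, so that unification can read off `P`, `start` and `size`.
  record Covers (P : ℕ → Set) (start size : Affine) : Set where
    constructor covers
    field at : ∀ i → i < eval size → P (eval start + i)

  open Covers public

  infixl 3 _▸_
  -- Adjacency of the two intervals is checked by computing `a ⊕ l`, so a chain of `▸` certifies a
  -- tiling without further proof.
  _▸_ : ∀ {P a l m} → Covers P a l → Covers P (a ⊕ l) m → Covers P a (l ⊕ m)
  at (_▸_ {P} {a} {l} {m} left right) i i<l+m with suc i ≤? eval l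
  ... | yes i<l = at left i i<l
  ... | no  i≮l = subst P eq (at right (i ∸ eval l) j<m)
    where
    l≤i = ≮⇒≥ i≮l
    eq : eval (a ⊕ l) + (i ∸ eval l) ≡ eval a + i
    eq = begin
      eval (a ⊕ l) + (i ∸ eval l)       ≡⟨ cong (_+ (i ∸ eval l)) (eval-⊕ a l) ⟩
      eval a + eval l + (i ∸ eval l)    ≡⟨ +-assoc (eval a) (eval l) _ ⟩
      eval a + (eval l + (i ∸ eval l))  ≡⟨ cong (eval a +_) (m+[n∸m]≡n l≤i) ⟩
      eval a + i                        ∎
      where open ≡-Reasoning
    j<m : i ∸ eval l < eval m
    j<m = +-cancelˡ-< (eval l) _ _
      (subst₂ _<_ (sym (m+[n∸m]≡n l≤i)) (eval-⊕ l m) i<l+m)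

  ⊕-≤ : ∀ {a b} δ → b ≡ a ⊕ δ → eval a ≤ eval b
  ⊕-≤ {a} δ refl = ≤-trans (m≤m+n (eval a) (eval δ)) (≤-reflexive (sym (eval-⊕ a δ)))

  -- Gaps within one block share their parity, so even and odd values are tiled separately. The
  -- slacks `δ` and `δ′` let the even or odd tiling reach past `n`, as the parity of `n` demands.
  interleave : ∀ {P n m m′} δ δ′ → m ⊕ m ≡ n ⊕ δ → num 1 ⊕ m′ ⊕ m′ ≡ n ⊕ δ′ →
               Covers (λ u → P (2 * u)) (num 0) m → Covers (λ u → P (1 + 2 * u)) (num 0) m′ →
               Covers P (num 0) n
  at (interleave {P} {n} {m} {m′} δ δ′ eq eq′ even odd) v v<n
    with v % 2 | m%n<n v 2 | m≡m%n+[m/n]*n v 2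
  ... | 0 | _ | v≡ = subst P (sym v≡2u) (at even (v / 2) (*-cancelˡ-< 2 _ _ 2u<2m))
    where
    v≡2u = trans v≡ (*-comm (v / 2) 2)
    double : eval (m ⊕ m) ≡ 2 * eval m
    double = trans (eval-⊕ m m) (cong (eval m +_) (sym (+-identityʳ _)))
    2u<2m : 2 * (v / 2) < 2 * eval m
    2u<2m = subst₂ _<_ v≡2u double (<-≤-trans v<n (⊕-≤ δ eq))
  ... | 1 | _ | v≡ = subst P (sym v≡1+2u) (at odd (v / 2) (*-cancelˡ-< 2 _ _ (s<s⁻¹ 1+2u<1+2m′)))
    where
    v≡1+2u = trans v≡ (cong suc (*-comm (v / 2) 2))
    double : eval (num 1 ⊕ m′ ⊕ m′) ≡ 1 + 2 * eval m′
    double = trans (eval-⊕ (num 1 ⊕ m′) m′) (cong (λ x → suc (eval m′ + x)) (sym (+-identityʳ _)))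
    1+2u<1+2m′ : 1 + 2 * (v / 2) < 1 + 2 * eval m′
    1+2u<1+2m′ = subst₂ _<_ v≡1+2u double (<-≤-trans v<n (⊕-≤ δ′ eq′))
  ... | suc (suc _) | s≤s (s≤s ()) | _

  -- Blocks of nested arcs and what they cover.

  -- Nested arcs with low ends [low , low + size) and high ends [high , high + size),
  -- listed from the innermost outwards.
  arcs : Block → List (ℕ × ℕ)
  arcs (block o a b l) =
    applyUpTo (λ i → orient o (eval a + (eval l ∸ suc i) , eval b + i)) (eval l)

  -- Low ends are listed backwards, so the `i`-th one stands at position `eval l ∸ suc i`.
  -- Generality in `g` and `o` serves rows of `up` blocks and columns of `down` blocks.
  lows-cover : ∀ g o {a b l} → (∀ e → g (orient o e) ≡ proj₁ e) →
               Covers (Hits g (arcs (block o a b l))) a l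
  at (lows-cover g o {a} {b} {l} eq) i i<l =
    applyUpTo⁺ _ (trans (eq (_ , eval b + (eval l ∸ suc i))) (cong (eval a +_) mirror)) l∸i-1<l
    where
    l∸i≡ : suc (eval l ∸ suc i) ≡ eval l ∸ i
    l∸i≡ = sym (+-∸-assoc 1 i<l)
    mirror : eval l ∸ suc (eval l ∸ suc i) ≡ i
    mirror = trans (cong (eval l ∸_) l∸i≡) (m∸[m∸n]≡n (<⇒≤ i<l))
    l∸i-1<l : eval l ∸ suc i < eval l
    l∸i-1<l = ≤-trans (≤-reflexive l∸i≡) (m∸n≤m (eval l) i)

  highs-cover : ∀ g o {a b l} → (∀ e → g (orient o e) ≡ proj₂ e) →
                Covers (Hits g (arcs (block o a b l))) b l
  at (highs-cover g o eq) i i<l = applyUpTo⁺ _ (eq _) i<l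

  rows-cover : ∀ B → Covers (Hits proj₁ (arcs B)) (rowStart B) (size B)
  rows-cover (block up   a b l) = lows-cover  proj₁ up   {a} {b} λ _ → refl
  rows-cover (block down a b l) = highs-cover proj₁ down {a} {b} λ _ → refl

  cols-cover : ∀ B → Covers (Hits proj₂ (arcs B)) (colStart B) (size B)
  cols-cover (block up   a b l) = highs-cover proj₂ up   {a} {b} λ _ → refl
  cols-cover (block down a b l) = lows-cover  proj₂ down {a} {b} λ _ → refl

  gap-orient : ∀ o e → gap (orient o e) ≡ gap e
  gap-orient up   _       = refl
  gap-orient down (x , y) = ∣-∣-comm y x

  -- The innermost gap is high - (low + size - 1) = c + 2 s, and each further arc adds 2.
  gaps-cover : ∀ B c s → num 1 ⊕ high B ≡ low B ⊕ size B ⊕ (num c ⊕ (s ⊕ s)) →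
               Covers (λ u → Hits gap (arcs B) (c + 2 * u)) s (size B)
  at (gaps-cover (block o a b l) c s eq) i i<l = applyUpTo⁺ _
    (trans (gap-orient o (eval a + r , eval b + i))
      (trans (cong ∣ eval a + r -_∣ b+i≡) (∣m-m+n∣≡n (eval a + r) _))) i<l
    where
    r = eval l ∸ suc i
    innermost : suc (eval b) ≡ eval a + eval l + (c + (eval s + eval s))
    innermost = begin
      suc (eval b)                                ≡⟨ cong eval eq ⟩
      eval (a ⊕ l ⊕ (num c ⊕ (s ⊕ s)))            ≡⟨ eval-⊕ (a ⊕ l) (num c ⊕ (s ⊕ s)) ⟩
      eval (a ⊕ l) + eval (num c ⊕ (s ⊕ s))       ≡⟨ cong₂ _+_ (eval-⊕ a l) (eval-⊕ (num c) (s ⊕ s)) ⟩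
      eval a + eval l + (c + 0 + eval (s ⊕ s))    ≡⟨ cong₂ (λ x y → eval a + eval l + (x + y))
                                                       (+-identityʳ c) (eval-⊕ s s) ⟩
      eval a + eval l + (c + (eval s + eval s))   ∎
      where open ≡-Reasoning
    regroup : ∀ a i r c s → a + (suc i + r) + (c + (s + s)) + i ≡ suc (a + r + (c + 2 * (s + i)))
    regroup = solve-∀
    b+i≡ : eval b + i ≡ eval a + r + (c + 2 * (eval s + i))
    b+i≡ = suc-injective (begin
      suc (eval b) + i                                      ≡⟨ cong (_+ i) innermost ⟩
      eval a + eval l + (c + (eval s + eval s)) + i         ≡⟨ cong (λ l → eval a + l + (c + (eval s + eval s)) + i)
                                                                 (m+[n∸m]≡n i<l) ⟨
      eval a + (suc i + r) + (c + (eval s + eval s)) + i    ≡⟨ regroup (eval a) i r c (eval s) ⟩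
      suc (eval a + r + (c + 2 * (eval s + i)))             ∎)
      where open ≡-Reasoning

  module Assembly (Bs : List Block) where

    graph : List (ℕ × ℕ)
    graph = concatMap arcs Bs

    totalSize : List Block → Affine
    totalSize = foldr (λ B → size B ⊕_) (num 0)

    length-graph : length graph ≡ eval (totalSize Bs)
    length-graph = go Bs
      where
      go : ∀ Bs → length (concatMap arcs Bs) ≡ eval (totalSize Bs)
      go []       = refl
      go (B ∷ Bs) = trans (length-++ (arcs B)) (trans
        (cong₂ _+_ (length-applyUpTo _ (eval (size B))) (go Bs)) (sym (eval-⊕ (size B) (totalSize Bs))))

    -- What one block covers, the whole graph covers; blocks can thus be cited in a different order
    -- for rows, columns and gaps.
    rows : ∀ {B} → B ∈ Bs → Covers (Hits proj₁ graph) (rowStart B) (size B)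
    at (rows {B} B∈Bs) i i<l = concatMap⁺ arcs (lose B∈Bs (at (rows-cover B) i i<l))

    cols : ∀ {B} → B ∈ Bs → Covers (Hits proj₂ graph) (colStart B) (size B)
    at (cols {B} B∈Bs) i i<l = concatMap⁺ arcs (lose B∈Bs (at (cols-cover B) i i<l))

    gaps : ∀ {B} c s → B ∈ Bs → num 1 ⊕ high B ≡ low B ⊕ size B ⊕ (num c ⊕ (s ⊕ s)) →
           Covers (λ u → Hits gap graph (c + 2 * u)) s (size B)
    at (gaps {B} c s B∈Bs eq) i i<l = concatMap⁺ arcs (lose B∈Bs (at (gaps-cover B c s eq) i i<l))

    differencePermutation :
      Covers (Hits proj₁ graph) (num 0) (totalSize Bs) →
      Covers (Hits proj₂ graph) (num 0) (totalSize Bs) →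
      Covers (Hits gap graph) (num 0) (totalSize Bs) →
      HasDifferencePermutation (eval (totalSize Bs))
    differencePermutation allRows allCols allGaps =
      graph⇒differencePermutation graph length-graph (at allRows) (at allCols) (at allGaps)

  -- The two families of cycles.

  -- Rosa's graceful labelling of the cycle with 4k edges, k = 1 + p, with the unused label 3k
  -- as fixed point.
  differencePermutation-5+4p : HasDifferencePermutation (5 + 4 * p)
  differencePermutation-5+4p = differencePermutation
    (rows #0 ▸ rows #1 ▸ rows #2 ▸ rows #3 ▸ rows #4 ▸ rows #5)
    (cols #2 ▸ cols #5 ▸ cols #3 ▸ cols #1 ▸ cols #4 ▸ cols #0)
    (interleave (num 1) (num 0) refl refl
      (gaps 0 (num 0) #4 refl ▸ gaps 0 (num 1) #3 refl ▸ gaps 0 (1 ∔ 1 ·p) #2 refl ▸ gaps 0 (2 ∔ 1 ·p) #0 refl)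
      (gaps 1 (num 0) #1 refl ▸ gaps 1 (1 ∔ 1 ·p) #5 refl))
    where
    -- The walk 0, 4k, 1, 4k-1, ..., 3k+1, k has the gaps 4k down to 2k+1; it skips 3k and goes on
    -- k, 3k-1, k+1, ..., 2k-1, 2k with the gaps 2k-1 down to 1. The arc from 2k back to 0 supplies
    -- the gap 2k.
    open Assembly
      ( block up   (num 0)    (4 ∔ 3 ·p) (1 ∔ 1 ·p)
      ∷ block up   (1 ∔ 1 ·p) (2 ∔ 2 ·p) (1 ∔ 1 ·p)
      ∷ block down (num 0)    (2 ∔ 2 ·p) (num 1)
      ∷ block down (2 ∔ 1 ·p) (3 ∔ 2 ·p) (0 ∔ 1 ·p)
      ∷ block up   (3 ∔ 3 ·p) (3 ∔ 3 ·p) (num 1)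
      ∷ block down (num 1)    (4 ∔ 3 ·p) (1 ∔ 1 ·p)
      ∷ [])

  -- Rosa's graceful labelling of the cycle with 4k - 1 edges, k = 1 + p, with the unused label k
  -- as fixed point.
  differencePermutation-4+4p : HasDifferencePermutation (4 + 4 * p)
  differencePermutation-4+4p = differencePermutation
    (rows #0 ▸ rows #1 ▸ rows #2 ▸ rows #3 ▸ rows #4 ▸ rows #5)
    (cols #3 ▸ cols #5 ▸ cols #1 ▸ cols #4 ▸ cols #2 ▸ cols #0)
    (interleave (num 0) (num 1) refl refl
      (gaps 0 (num 0) #1 refl ▸ gaps 0 (num 1) #2 refl ▸ gaps 0 (1 ∔ 1 ·p) #3 refl ▸ gaps 0 (2 ∔ 1 ·p) #5 refl)
      (gaps 1 (num 0) #4 refl ▸ gaps 1 (1 ∔ 1 ·p) #0 refl))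
    where
    -- The walk 0, 4k-1, 1, 4k-2, ..., k-1, 3k has the gaps 4k-1 down to 2k+1; it skips k and goes
    -- on 3k, k+1, 3k-1, ..., 2k+1, 2k with the gaps 2k-1 down to 1. Again 2k to 0 supplies the gap
    -- 2k.
    open Assembly
      ( block up   (num 0)    (3 ∔ 3 ·p) (1 ∔ 1 ·p)
      ∷ block up   (1 ∔ 1 ·p) (1 ∔ 1 ·p) (num 1)
      ∷ block up   (2 ∔ 1 ·p) (3 ∔ 2 ·p) (0 ∔ 1 ·p)
      ∷ block down (num 0)    (2 ∔ 2 ·p) (num 1)
      ∷ block down (2 ∔ 1 ·p) (3 ∔ 2 ·p) (1 ∔ 1 ·p)
      ∷ block down (num 1)    (4 ∔ 3 ·p) (0 ∔ 1 ·p)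
      ∷ [])

mod4⇒differencePermutation : ∀ n → n ≥ 1 → ZeroOrOneMod4 n → HasDifferencePermutation n
mod4⇒differencePermutation n n≥1 (inj₁ n%4≡0)
  with n / 4 | trans (m≡m%n+[m/n]*n n 4) (cong (_+ n / 4 * 4) n%4≡0)
... | zero  | refl = contradiction n≥1 λ ()
... | suc p | refl = subst HasDifferencePermutation (cong (4 +_) (*-comm 4 p)) (differencePermutation-4+4p p)
mod4⇒differencePermutation n _ (inj₂ n%4≡1)
  with n / 4 | trans (m≡m%n+[m/n]*n n 4) (cong (_+ n / 4 * 4) n%4≡1)
-- The cycles start at k = 1, so n = 1 is done by hand.
... | zero  | refl = idₚ , λ { zero _ → zero , refl , λ { {zero} _ → refl }
                             ; (suc _) (s≤s ()) }
... | suc p | refl = subst HasDifferencePermutation (cong (5 +_) (*-comm 4 p)) (differencePermutation-5+4p p)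

theorem1 : (n : ℕ) → n ≥ 1 →
    (Solvable (T n) ⇔ ZeroOrOneMod4 n) × (HasDifferencePermutation n ⇔ ZeroOrOneMod4 n)
theorem1 n n≥1 =
    mk⇔ solvable⇒mod4 (differencePermutation⇒solvable ∘ mod4⇒differencePermutation n n≥1)
  , mk⇔ differencePermutation⇒mod4 (mod4⇒differencePermutation n n≥1)
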